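{- Let $T$ be a forest with no isolated vertices and with no two distinct vertices $u,v$ satisfying $N(u)=N(v)$. Then $T$ is an iso-unique Grundy total domination graph if and only if $\gamma_{gr}^{t}(T)=n(T)$.
   Context: For a vertex $v$, $N(v)$ is its open neighborhood. An open neighborhood sequence of $G$ is a sequence $(v_1,\ldots,v_k)$ of distinct vertices such that for each $i\in[k]$, $N(v_i)\setminus\bigcup_{j=1}^{i-1}N(v_j)\neq\emptyset$. $\gamma_{gr}^{t}(G)$ is the maximum length of such a sequence, and a Grundy total dominating set is the set of vertices of a maximum-length one. $G$ is an iso-unique Grundy total domination graph if for every two Grundy total dominating sets $A,B$ there is an automorphism $\phi$ of $G$ with $\phi(A)=B$. $n(T)$ is the number of vertices of $T$. -}

module Defs where

open import Data.Nat using (ℕ; _≤_; _<_)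
open import Data.Fin using (Fin; toℕ)
open import Data.List using (List; []; _∷_; _++_; [_]; length; lookup)
open import Data.List.Relation.Unary.Unique.Propositional using (Unique)
open import Data.List.Relation.Unary.Linked using (Linked)
open import Data.List.Membership.Propositional using (_∈_)
open import Data.Product using (Σ; ∃; ∃-syntax; _×_; _,_)
open import Relation.Nullary using (¬_)
open import Relation.Binary using (Decidable)
open import Relation.Binary.PropositionalEquality using (_≡_)
open import Function.Bundles using (_⇔_; _↔_; Inverse)

record Graph : Set₁ where
  field
    n     : ℕ
    _~_   : Fin n → Fin n → Set
    adj?  : Decidable _~_
    sym   : ∀ {u v} → u ~ v → v ~ u
    irrefl : ∀ {u} → ¬ (u ~ u)

module _ (G : Graph) where
  open Graph G

  order : ℕ
  order = n

  record Cycle : Set where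
    field
      start : Fin n
      rest  : List (Fin n)
      long  : 2 ≤ length rest
      distinct : Unique (start ∷ rest)
      closed   : Linked _~_ (start ∷ rest ++ [ start ])

  Forest : Set
  Forest = ¬ Cycle

  NoIsolated : Set
  NoIsolated = ∀ v → ∃[ u ] (v ~ u)

  TwinFree : Set
  TwinFree = ∀ u v → (∀ w → (u ~ w) ⇔ (v ~ w)) → u ≡ v

  IsONSeq : List (Fin n) → Set
  IsONSeq s = Unique s ×
    (∀ (i : Fin (length s)) → ∃[ w ] (lookup s i ~ w ×
       (∀ (j : Fin (length s)) → toℕ j < toℕ i → ¬ (lookup s j ~ w))))

  IsGrundyTotalSeq : List (Fin n) → Set
  IsGrundyTotalSeq s = IsONSeq s × (∀ t → IsONSeq t → length t ≤ length s)

  GrundyTotalNumberIs : ℕ → Set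
  GrundyTotalNumberIs k = Σ (List (Fin n)) (λ s → IsGrundyTotalSeq s × length s ≡ k)
                          × (∀ t → IsONSeq t → length t ≤ k)

  record Automorphism : Set where
    field
      perm : Fin n ↔ Fin n
      preserves : ∀ u v → (u ~ v) ⇔ (Inverse.to perm u ~ Inverse.to perm v)

  -- Grundy total dominating sets are the vertex sets of maximum-length
  -- open neighbourhood sequences; iso-unique: any two are related by an automorphism
  IsoUniqueGrundyTotal : Set
  IsoUniqueGrundyTotal = ∀ A B → IsGrundyTotalSeq A → IsGrundyTotalSeq B →
    Σ Automorphism (λ φ → ∀ x → x ∈ B ⇔ (∃[ a ] (a ∈ A × Inverse.to (Automorphism.perm φ) a ≡ x)))

{-# OPTIONS --safe #-}
-- Attach to each v_i of an open neighbourhood sequence a witness w_i. The pairs (v_i , w_i) form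
-- a matching between two copies of the vertex set, and in a forest every such matching can be
-- reordered into a sequence: otherwise one could walk forever without backtracking. Maximum
-- matchings thus describe Grundy total dominating sets, and they allow exchange: if x is not used
-- as a first component and x ~ y, then y is matched to some v, and v can be replaced by x.
--
-- If a leaf l were missing, exchanging it in would remove a non-leaf (by twin-freeness), and two
-- Grundy sets with different numbers of leaves would arise; so iso-uniqueness forces every
-- Grundy set to contain all leaves. If then some x were missing, exchanging along the edges of a
-- walk x, y, v, y', v', ... would never stop, since each missing vertex is not a leaf; but this walk
-- does not backtrack, which is impossible in a forest.
module Submission where

open import Defs
open import Data.Empty using (⊥-elim)
open import Data.Fin using (Fin; zero; suc; toℕ)
open import Data.Fin.Properties as Fin using (any?; all?; pigeonhole; injective⇒≤; toℕ-injective)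
open import Data.List using (List; []; _∷_; _++_; [_]; length; lookup; map; tabulate)
open import Data.List.Membership.Propositional using (_∈_; _∉_; find)
open import Data.List.Membership.Propositional.Properties using (∈-∃++; ∈-lookup; ∈-map⁺; ∈-map⁻)
import Data.List.Membership.DecPropositional as DecMembership
open import Data.List.Properties using (length-map; map-tabulate; tabulate-lookup)
open import Data.List.Relation.Binary.Permutation.Propositional as ↭ using (_↭_; ↭-sym; ↭⇒↭ₛ)
open import Data.List.Relation.Binary.Permutation.Propositional.Properties
  using (All-resp-↭; ∈-resp-↭; ↭-length; shift; map⁺)
import Data.List.Relation.Binary.Permutation.Setoid.Properties as ↭ₛ
open import Data.List.Relation.Unary.All as All using (All; []; _∷_)
open import Data.List.Relation.Unary.All.Properties using (¬Any⇒All¬; ¬All⇒Any¬; All¬⇒¬Any; ++⁻ˡ)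
  renaming (tabulate⁺ to All-tabulate⁺)
open import Data.List.Relation.Unary.AllPairs using (AllPairs; []; _∷_)
open import Data.List.Relation.Unary.Any as Any using (Any; here; there)
open import Data.List.Relation.Unary.Any.Properties using (lookup-index)
open import Data.List.Relation.Unary.Linked using (Linked; [-]; _∷_)
open import Data.List.Relation.Unary.Unique.Propositional using (Unique)
open import Data.List.Relation.Unary.Unique.Propositional.Properties
  using () renaming (tabulate⁺ to Unique-tabulate⁺)
import Data.List.Relation.Unary.Unique.DecPropositional as DecUnique
open import Data.Nat using (ℕ; zero; suc; _+_; _≤_; _<_; z≤n; s≤s; s<s)
open import Data.Nat.Properties as ℕ
  using (≤-refl; ≤-reflexive; ≤-trans; ≤-antisym; 1+n≰n; <⇒≱; ≤-pred; +-suc; <-cmp)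
open import Data.Nat.GeneralisedArithmetic using (fold)
open import Data.Product using (∃; ∃₂; ∃-syntax; _×_; _,_; proj₁; proj₂)
open import Data.Product.Properties using (≡-dec)
open import Data.Sum using (_⊎_; inj₁; inj₂)
open import Function using (_∘_)
open import Function.Bundles using (_⇔_; mk⇔; Equivalence; Inverse)
open import Function.Construct.Identity using (↔-id; ⇔-id)
open import Relation.Binary using (tri<; tri≈; tri>)
open import Relation.Binary.PropositionalEquality
  using (_≡_; _≢_; refl; sym; trans; cong; subst; setoid)
open import Relation.Nullary using (¬_; Dec; yes; no)
open import Relation.Nullary.Decidable using (map′; ¬?; _×-dec_; _⊎-dec_; _→-dec_; decidable-stable)

-- Lists: permutations, distinct entries, linked paths.

module _ {A : Set} where

  Unique-resp-↭ : {xs ys : List A} → xs ↭ ys → Unique xs → Unique ys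
  Unique-resp-↭ = ↭ₛ.Unique-resp-↭ (setoid A) ∘ ↭⇒↭ₛ

  ∈⇒↭∷ : {x : A} {xs : List A} → x ∈ xs → ∃[ ys ] xs ↭ x ∷ ys
  ∈⇒↭∷ {x} x∈xs with ys , zs , refl ← ∈-∃++ x∈xs = ys ++ zs , shift x ys zs

  ∉⇒All≢ : {x : A} {xs : List A} → x ∉ xs → All (x ≢_) xs
  ∉⇒All≢ = ¬Any⇒All¬ _

  Unique-head : {x : A} {xs : List A} → Unique (x ∷ xs) → x ∉ xs
  Unique-head (x≢ ∷ _) = All¬⇒¬Any x≢

  Unique-prefix : (xs : List A) {ys : List A} → Unique (xs ++ ys) → Unique xs
  Unique-prefix []       _        = []
  Unique-prefix (_ ∷ xs) (x≢ ∷ u) = ++⁻ˡ xs x≢ ∷ Unique-prefix xs u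

  Unique-lookup-injective : {xs : List A} → Unique xs →
    {i j : Fin (length xs)} → lookup xs i ≡ lookup xs j → i ≡ j
  Unique-lookup-injective {_ ∷ _} _ {zero} {zero} _ = refl
  Unique-lookup-injective {_ ∷ xs} (x≢ ∷ _) {zero} {suc j} eq =
    ⊥-elim (All.lookup x≢ (∈-lookup j) eq)
  Unique-lookup-injective u@(_ ∷ _) {suc i} {zero} eq =
    sym (Unique-lookup-injective u {zero} {suc i} (sym eq))
  Unique-lookup-injective {_ ∷ _} (_ ∷ u) {suc i} {suc j} eq =
    cong suc (Unique-lookup-injective u eq)

  Linked-prefix : {R : A → A → Set} (xs : List A) {y : A} {ys : List A} →
    Linked R (xs ++ y ∷ ys) → Linked R (xs ++ [ y ])
  Linked-prefix []           _       = [-]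
  Linked-prefix (_ ∷ [])     (r ∷ _) = r ∷ [-]
  Linked-prefix (_ ∷ x ∷ xs) (r ∷ l) = r ∷ Linked-prefix (x ∷ xs) l

module _ {A B : Set} where

  Unique-map-injective : (f : A → B) {xs : List A} → Unique (map f xs) →
    ∀ {x y} → x ∈ xs → y ∈ xs → f x ≡ f y → x ≡ y
  Unique-map-injective f (_ ∷ _) (here refl) (here refl) _  = refl
  Unique-map-injective f u (here refl) (there y∈) eq =
    ⊥-elim (Unique-head u (subst (_∈ map f _) (sym eq) (∈-map⁺ f y∈)))
  Unique-map-injective f u (there x∈) (here refl) eq =
    ⊥-elim (Unique-head u (subst (_∈ map f _) eq (∈-map⁺ f x∈)))
  Unique-map-injective f (_ ∷ u) (there x∈) (there y∈) eq = Unique-map-injective f u x∈ y∈ eq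

-- Counting and searching over a finite set.

module _ {n : ℕ} where

  open DecMembership (Fin._≟_ {n}) using (_∈?_)

  Unique⇒length≤ : {xs : List (Fin n)} → Unique xs → length xs ≤ n
  Unique⇒length≤ u = injective⇒≤ (Unique-lookup-injective u)

  all∈⇒≤length : {xs : List (Fin n)} → (∀ x → x ∈ xs) → n ≤ length xs
  all∈⇒≤length {xs} all = injective⇒≤ {f = λ x → Any.index (all x)} λ {x} {y} eq →
    trans (lookup-index (all x)) (trans (cong (lookup xs) eq) (sym (lookup-index (all y))))

  Unique⇒all∈ : {xs : List (Fin n)} → Unique xs → n ≤ length xs → ∀ x → x ∈ xs
  Unique⇒all∈ {xs} u n≤ x = decidable-stable (x ∈? xs) λ x∉ →
    1+n≰n (≤-trans (Unique⇒length≤ (∉⇒All≢ x∉ ∷ u)) n≤)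

  ∃List? : (k : ℕ) {P : List (Fin n) → Set} → (∀ xs → Dec (P xs)) →
    Dec (∃[ xs ] (P xs × length xs ≡ k))
  ∃List? zero P? = map′ (λ p → [] , p , refl) (λ { ([] , p , _) → p }) (P? [])
  ∃List? (suc k) P? = map′
    (λ { (x , xs , p , refl) → x ∷ xs , p , refl })
    (λ { (x ∷ xs , p , refl) → x , xs , p , refl })
    (any? λ x → ∃List? k (P? ∘ (x ∷_)))

  -- By pigeonhole two of the iterates 0, ..., n of `x` agree, and injectivity strips the common
  -- applications of `f`. Writing `suc k` keeps the period positive.
  injective⇒periodic : (f : Fin n → Fin n) → (∀ {x y} → f x ≡ f y → x ≡ y) →
    ∀ x → ∃[ k ] fold x f (suc k) ≡ x
  injective⇒periodic f f-inj x with i , j , i<j , eq ← pigeonhole ≤-refl (fold x f ∘ toℕ) =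
    cancel (toℕ i) (toℕ j) i<j eq
    where
    cancel : ∀ a b → a < b → fold x f a ≡ fold x f b → ∃[ k ] fold x f (suc k) ≡ x
    cancel zero    (suc b) _         eq = b , sym eq
    cancel (suc a) (suc b) (s<s a<b) eq = cancel a b a<b (f-inj eq)

-- Matchings between two copies of the vertex set, and exchange.

module _ (T : Graph) where

  open Graph T renaming (sym to ~-sym)
  open DecMembership (Fin._≟_ {n}) using (_∈?_)
  open DecUnique (Fin._≟_ {n}) using (unique?)

  V : Set
  V = Fin n

  _≟_ : (p q : V × V) → Dec (p ≡ q)
  _≟_ = ≡-dec Fin._≟_ Fin._≟_

  Leaf : V → Set
  Leaf v = ∀ {w w′} → v ~ w → v ~ w′ → w ≡ w′

  -- A matching in the bipartite double cover of `T`, not in `T` itself: a vertex may occur once as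
  -- a first and once as a second component.
  record Matching (M : List (V × V)) : Set where
    field
      unique₁  : Unique (map proj₁ M)
      unique₂  : Unique (map proj₂ M)
      adjacent : All (λ p → proj₁ p ~ proj₂ p) M
  open Matching

  Maximum : List (V × V) → Set
  Maximum M = Matching M × (∀ N → Matching N → length N ≤ length M)

  Matching-resp-↭ : ∀ {M N} → M ↭ N → Matching M → Matching N
  Matching-resp-↭ M↭N m = record
    { unique₁  = Unique-resp-↭ (map⁺ proj₁ M↭N) (unique₁ m)
    ; unique₂  = Unique-resp-↭ (map⁺ proj₂ M↭N) (unique₂ m)
    ; adjacent = All-resp-↭ M↭N (adjacent m)
    }

  Matching-tail : ∀ {p M} → Matching (p ∷ M) → Matching M
  Matching-tail m with _ ∷ u₁ ← unique₁ m | _ ∷ u₂ ← unique₂ m | _ ∷ a ← adjacent m =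
    record { unique₁ = u₁ ; unique₂ = u₂ ; adjacent = a }

  Matching-∷ : ∀ {v w M} → v ~ w → v ∉ map proj₁ M → w ∉ map proj₂ M → Matching M →
    Matching ((v , w) ∷ M)
  Matching-∷ v~w v∉ w∉ m = record
    { unique₁  = ∉⇒All≢ v∉ ∷ unique₁ m
    ; unique₂  = ∉⇒All≢ w∉ ∷ unique₂ m
    ; adjacent = v~w ∷ adjacent m
    }

  -- If `y` were free on the second side, adding `(x , y)` would enlarge `M`. So `y` has a partner
  -- `v`, and replacing it by `x` keeps the length, hence maximality, while `v` drops out.
  exchange : ∀ {M x y} → Maximum M → x ∉ map proj₁ M → x ~ y →
    ∃₂ λ v N → M ↭ (v , y) ∷ N × v ~ y × v ∉ map proj₁ ((x , y) ∷ N) × Maximum ((x , y) ∷ N)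
  exchange {M} {x} {y} (m , max) x∉ x~y with y ∈? map proj₂ M
  ... | no y∉ = ⊥-elim (1+n≰n (max _ (Matching-∷ x~y x∉ y∉ m)))
  ... | yes y∈ with (v , y) , vy∈ , refl ← ∈-map⁻ proj₂ y∈
               with N , M↭ ← ∈⇒↭∷ vy∈ =
    v , N , M↭ , All.lookup (adjacent m) vy∈ ,
    (λ { (here refl) → x∉ (∈-map⁺ proj₁ vy∈)
       ; (there v∈)  → Unique-head (unique₁ m′) v∈ }) ,
    Matching-∷ x~y x∉N (Unique-head (unique₂ m′)) (Matching-tail m′) ,
    λ L l → ≤-trans (max L l) (≤-reflexive (↭-length M↭))
    where
    m′ : Matching ((v , y) ∷ N)
    m′ = Matching-resp-↭ M↭ m
    x∉N : x ∉ map proj₁ N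
    x∉N = x∉ ∘ ∈-resp-↭ (↭-sym (map⁺ proj₁ M↭)) ∘ there

  -- Open neighbourhood sequences as ordered matchings.

  IsONSeq⇒Matching : ∀ {s} → IsONSeq T s → ∃[ M ] (map proj₁ M ≡ s × Matching M)
  IsONSeq⇒Matching {s} (u , wit) = tabulate (λ i → lookup s i , w i) , eq₁ , record
    { unique₁  = subst Unique (sym eq₁) u
    ; unique₂  = subst Unique (sym (map-tabulate _ proj₂)) (Unique-tabulate⁺ w-injective)
    ; adjacent = All-tabulate⁺ (λ i → proj₁ (proj₂ (wit i)))
    }
    where
    w : Fin (length s) → V
    w i = proj₁ (wit i)
    eq₁ : map proj₁ (tabulate (λ i → lookup s i , w i)) ≡ s
    eq₁ = trans (map-tabulate _ proj₁) (tabulate-lookup s)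
    -- The witness of `j` is adjacent to no earlier term, but the witness of `i` is adjacent to term
    -- `i`.
    earlier-differs : ∀ {i j} → toℕ i < toℕ j → w i ≢ w j
    earlier-differs {i} {j} i<j eq =
      proj₂ (proj₂ (wit j)) i i<j (subst (lookup s i ~_) eq (proj₁ (proj₂ (wit i))))
    w-injective : ∀ {i j} → w i ≡ w j → i ≡ j
    w-injective {i} {j} eq with <-cmp (toℕ i) (toℕ j)
    ... | tri< i<j _ _ = ⊥-elim (earlier-differs i<j eq)
    ... | tri≈ _ i≡j _ = toℕ-injective i≡j
    ... | tri> _ _ j<i = ⊥-elim (earlier-differs j<i (sym eq))

  -- With first components as rows and second components as columns, the adjacency matrix is lower
  -- triangular.
  Triangular : List (V × V) → Set
  Triangular = AllPairs (λ p q → ¬ (proj₁ p ~ proj₂ q))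

  Triangular⇒IsONSeq : ∀ {M} → Matching M → Triangular M → IsONSeq T (map proj₁ M)
  Triangular⇒IsONSeq {M} m t = unique₁ m , λ i →
    let w , _ , v~w , fresh = witness M (adjacent m) t i in w , v~w , fresh
    where
    -- Keeping `w` among the second components of `N` lets the induction apply the triangularity of
    -- a new head to it.
    witness : ∀ N → All (λ p → proj₁ p ~ proj₂ p) N → Triangular N →
      (i : Fin (length (map proj₁ N))) →
      ∃[ w ] (w ∈ map proj₂ N × lookup (map proj₁ N) i ~ w ×
        (∀ j → toℕ j < toℕ i → ¬ (lookup (map proj₁ N) j ~ w)))
    witness ((_ , w) ∷ N) (v~w ∷ _) _ zero = w , here refl , v~w , λ _ ()
    witness ((v , _) ∷ N) (_ ∷ a) (v≁ ∷ t) (suc i)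
      with w , w∈ , v~w , fresh ← witness N a t i = w , there w∈ , v~w , λ
        { zero    _         v~w → let _ , q∈ , eq = ∈-map⁻ proj₂ w∈ in
                                  All.lookup v≁ q∈ (subst (v ~_) eq v~w)
        ; (suc j) (s<s j<i) → fresh j j<i }

  -- Existence of Grundy sequences, and the direction from order to iso-uniqueness.

  IsONSeq? : ∀ s → Dec (IsONSeq T s)
  IsONSeq? s = unique? s ×-dec all? λ i → any? λ w → adj? (lookup s i) w ×-dec
    all? λ j → (toℕ j ℕ.<? toℕ i) →-dec ¬? (adj? (lookup s j) w)

  ∃IsGrundyTotalSeq : ∃ (IsGrundyTotalSeq T)
  ∃IsGrundyTotalSeq = search n (λ _ t → Unique⇒length≤ (proj₁ t))
    where
    -- The bound descends from `n`; the first length that is attained is the maximum.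
    search : ∀ k → (∀ t → IsONSeq T t → length t ≤ k) → ∃ (IsGrundyTotalSeq T)
    search k bound with ∃List? k IsONSeq?
    search k bound       | yes (s , s-on , refl) = s , s-on , bound
    search zero bound    | no _  = [] , ([] , λ ()) , bound
    search (suc k) bound | no ¬s = search k λ t t-on → ≤-pred
      (ℕ.≤∧≢⇒< (bound t t-on) λ eq → ¬s (t , t-on , eq))

  iso-preserves-leaf : (φ : Automorphism T) → ∀ {v} → Leaf v →
    Leaf (Inverse.to (Automorphism.perm φ) v)
  iso-preserves-leaf φ {v} leaf {w} {w′} φv~w φv~w′ =
    trans (sym (to∘from w)) (trans (cong to (leaf (pullback φv~w) (pullback φv~w′))) (to∘from w′))
    where
    open Automorphism φ
    open Inverse perm using (to; from) renaming (strictlyInverseˡ to to∘from)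
    pullback : ∀ {w} → to v ~ w → v ~ from w
    pullback {w} e = Equivalence.from (preserves v (from w)) (subst (to v ~_) (sym (to∘from w)) e)

  -- Every Grundy set is then the whole vertex set, so the identity automorphism serves.
  GrundyTotalNumberIs-order⇒IsoUnique : GrundyTotalNumberIs T n → IsoUniqueGrundyTotal T
  GrundyTotalNumberIs-order⇒IsoUnique ((s , (s-on , _) , order≡) , _) A B gA gB =
    record { perm = ↔-id _ ; preserves = λ _ _ → ⇔-id _ } ,
    λ x → mk⇔ (λ _ → x , full gA x , refl) (λ _ → full gB x)
    where
    full : ∀ {C} → IsGrundyTotalSeq T C → ∀ x → x ∈ C
    full ((u , _) , max) = Unique⇒all∈ u (≤-trans (≤-reflexive (sym order≡)) (max s s-on))

  -- Forests: non-backtracking walks and reordering of matchings.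

  module _ (forest : Forest T) where

    extend-path : ∀ {x v u p} → Unique (v ∷ u ∷ p) → Linked _~_ (v ∷ u ∷ p) →
      v ~ x → x ≢ u → Unique (x ∷ v ∷ u ∷ p)
    extend-path {x} {v} {u} {p} uniq link v~x x≢u = ∉⇒All≢ x∉ ∷ uniq
      where
      x∉ : x ∉ v ∷ u ∷ p
      x∉ (here refl)          = irrefl v~x
      x∉ (there (here x≡u))   = x≢u x≡u
      -- Cutting `p` where `x` occurs leaves the cycle `x`, `v`, `u`, `as`, back to `x`.
      x∉ (there (there x∈p)) with as , bs , refl ← ∈-∃++ x∈p = forest (record
        { start    = x
        ; rest     = v ∷ u ∷ as
        ; long     = s≤s (s≤s z≤n)
        ; distinct = Unique-prefix (x ∷ v ∷ u ∷ as)
                       (Unique-resp-↭ (shift x (v ∷ u ∷ as) bs) uniq)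
        ; closed   = ~-sym v~x ∷ Linked-prefix (v ∷ u ∷ as) link
        })

    -- Q u v : a walk may arrive at v along the edge from u, so x ≢ u and y ≢ v forbid backtracking.
    no-endless-walk : (Q : V → V → Set) →
      (∀ {u v} → Q u v → ∃₂ λ x y → v ~ x × x ~ y × x ≢ u × y ≢ v × Q x y) →
      ∀ {u v} → u ~ v → ¬ Q u v
    no-endless-walk Q step {u} {v} u~v =
      grow n ((v≢u ∷ []) ∷ [] ∷ []) (~-sym u~v ∷ [-]) (s≤s (ℕ.m≤n+m n 1))
      where
      v≢u : v ≢ u
      v≢u refl = irrefl u~v
      -- Each round spends one unit of fuel and adds two vertices, so length plus fuel stays above
      -- `n`; with no fuel left, the path has more than `n` distinct vertices.
      grow : ∀ fuel {u v p} → Unique (v ∷ u ∷ p) → Linked _~_ (v ∷ u ∷ p) →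
        n < length (v ∷ u ∷ p) + fuel → ¬ Q u v
      grow zero uniq _ n< _ = <⇒≱ n< (≤-trans (≤-reflexive (ℕ.+-identityʳ _)) (Unique⇒length≤ uniq))
      grow (suc fuel) {u} {v} {p} uniq link n< q with x , y , v~x , x~y , x≢u , y≢v , q′ ← step q =
        grow fuel (extend-path uniq₁ link₁ x~y y≢v) (~-sym x~y ∷ link₁)
          (≤-trans n< (≤-trans (≤-reflexive (+-suc (length (v ∷ u ∷ p)) fuel)) (ℕ.n≤1+n _))) q′
        where
        uniq₁ : Unique (x ∷ v ∷ u ∷ p)
        uniq₁ = extend-path uniq link v~x x≢u
        link₁ : Linked _~_ (x ∷ v ∷ u ∷ p)
        link₁ = ~-sym v~x ∷ link

    -- A pair whose first component is adjacent to no second component but its own can go first, and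
    -- the rest is sorted recursively. The recursion is on the length `k`, because removing the pair
    -- permutes the list.
    triangulate : ∀ k M → length M ≡ k → Matching M → ∃[ N ] (N ↭ M × Triangular N)
    triangulate zero    []         _   _ = [] , ↭.refl , []
    triangulate (suc k) M@(_ ∷ _) len m with Any.any? first? M
      where
      first? : ∀ p → Dec (All (λ q → q ≡ p ⊎ ¬ (proj₁ p ~ proj₂ q)) M)
      first? p = All.all? (λ q → (q ≟ p) ⊎-dec ¬? (adj? (proj₁ p) (proj₂ q))) M
    ... | yes some with p , p∈ , isFirst ← find some with M′ , M↭ ← ∈⇒↭∷ p∈
          with N , N↭ , t ← triangulate k M′ (ℕ.suc-injective (trans (sym (↭-length M↭)) len))
                              (Matching-tail (Matching-resp-↭ M↭ m)) =
      p ∷ N , ↭.trans (↭.prep p N↭) (↭-sym M↭) ,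
      All-resp-↭ (↭-sym N↭) (All.tabulate avoid) ∷ t
      where
      avoid : ∀ {q} → q ∈ M′ → ¬ (proj₁ p ~ proj₂ q)
      avoid q∈ with All.lookup isFirst (∈-resp-↭ (↭-sym M↭) (there q∈))
      ... | inj₂ ≁    = ≁
      ... | inj₁ refl = ⊥-elim
        (Unique-head (unique₁ (Matching-resp-↭ M↭ m)) (∈-map⁺ proj₁ q∈))
    -- Otherwise each pair `(v , u)` has another pair `(y , x)` with `v ~ x`. Distinct pairs of a
    -- matching differ in both components, so the walk `u`, `v`, `x`, `y`, ... never backtracks.
    ... | no none = ⊥-elim
      (no-endless-walk (λ u v → (v , u) ∈ M) step (~-sym (All.head (adjacent m))) (here refl))
      where
      step : ∀ {u v} → (v , u) ∈ M →
        ∃₂ λ x y → v ~ x × x ~ y × x ≢ u × y ≢ v × (y , x) ∈ M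
      step {u} {v} vu∈
        with (y , x) , yx∈ , blocks ← find (¬All⇒Any¬
               (λ q → (q ≟ (v , u)) ⊎-dec ¬? (adj? v (proj₂ q))) M
               (All.lookup (¬Any⇒All¬ M none) vu∈)) =
        x , y , decidable-stable (adj? v x) (blocks ∘ inj₂) , ~-sym (All.lookup (adjacent m) yx∈) ,
        (λ x≡u → blocks (inj₁ (Unique-map-injective proj₂ (unique₂ m) yx∈ vu∈ x≡u))) ,
        (λ y≡v → blocks (inj₁ (Unique-map-injective proj₁ (unique₁ m) yx∈ vu∈ y≡v))) ,
        yx∈

    Matching⇒IsONSeq : ∀ {M} → Matching M → ∃[ s ] (s ↭ map proj₁ M × IsONSeq T s)
    Matching⇒IsONSeq {M} m with N , N↭M , t ← triangulate _ M refl m =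
      map proj₁ N , map⁺ proj₁ N↭M , Triangular⇒IsONSeq (Matching-resp-↭ (↭-sym N↭M) m) t

    ↭-length-proj₁ : ∀ {s} {M : List (V × V)} → s ↭ map proj₁ M → length s ≡ length M
    ↭-length-proj₁ {M = M} s↭ = trans (↭-length s↭) (length-map proj₁ M)

    -- Both translations preserve length, so the two maxima coincide; this and `Grundy⇒Maximum`
    -- identify Grundy sets with first sides of maximum matchings.
    Maximum⇒Grundy : ∀ {M} → Maximum M → ∃[ s ] (s ↭ map proj₁ M × IsGrundyTotalSeq T s)
    Maximum⇒Grundy (m , max) with s , s↭ , s-on ← Matching⇒IsONSeq m =
      s , s↭ , s-on , bound
      where
      bound : ∀ t → IsONSeq T t → length t ≤ length s
      bound t t-on with N , refl , n-m ← IsONSeq⇒Matching t-on =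
        ≤-trans (≤-reflexive (length-map proj₁ N))
          (≤-trans (max N n-m) (≤-reflexive (sym (↭-length-proj₁ s↭))))

    Grundy⇒Maximum : ∀ {s} → IsGrundyTotalSeq T s → ∃[ M ] (map proj₁ M ≡ s × Maximum M)
    Grundy⇒Maximum (s-on , max) with M , refl , m ← IsONSeq⇒Matching s-on = M , refl , m , bound
      where
      bound : ∀ N → Matching N → length N ≤ length M
      bound N n-m with t , t↭ , t-on ← Matching⇒IsONSeq n-m =
        ≤-trans (≤-reflexive (sym (↭-length-proj₁ t↭)))
          (≤-trans (max t t-on) (≤-reflexive (length-map proj₁ M)))

    -- Leaves, and the consequences of iso-uniqueness.

    module _ (noIsolated : NoIsolated T) (twinFree : TwinFree T) where

      leaf-twins : ∀ {u v w} → Leaf u → Leaf v → u ~ w → v ~ w → u ≡ v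
      leaf-twins u-leaf v-leaf u~w v~w = twinFree _ _ λ x → mk⇔
        (λ u~x → subst (_ ~_) (u-leaf u~w u~x) v~w)
        (λ v~x → subst (_ ~_) (v-leaf v~w v~x) u~w)

      module _ (isoUnique : IsoUniqueGrundyTotal T) where

        -- Leaves are compared through an orbit instead of a count: `φ` sends the leaves of `B` to
        -- leaves of `A`, which lie in `B` again. So all later iterates of `l` stay in `A`, and
        -- periodicity returns to `l` itself.
        Maximum-contains-leaf : ∀ {M l} → Maximum M → Leaf l → l ∈ map proj₁ M
        Maximum-contains-leaf {M} {l} maxM l-leaf = decidable-stable (l ∈? map proj₁ M) contra
          where
          contra : ¬ (l ∉ map proj₁ M)
          contra l∉
            with p , l~p ← noIsolated l
            with v , N , M↭ , v~p , v∉ , maxN ← exchange maxM l∉ l~p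
            with A , A↭ , gA ← Maximum⇒Grundy maxM
            with B , B↭ , gB ← Maximum⇒Grundy maxN
            with φ , φB≡A ← isoUnique B A gB gA
            = l∉ (∈-resp-↭ A↭ (subst (_∈ A) period (proj₁ (orbit k))))
            where
            open Inverse (Automorphism.perm φ) using (to; from)
              renaming (strictlyInverseʳ to from∘to)
            to-injective : ∀ {x y} → to x ≡ to y → x ≡ y
            to-injective eq = trans (sym (from∘to _)) (trans (cong from eq) (from∘to _))
            k = proj₁ (injective⇒periodic to to-injective l)
            period = proj₂ (injective⇒periodic to to-injective l)
            A-leaf⊆B : ∀ {x} → x ∈ A → Leaf x → x ∈ B
            A-leaf⊆B x∈A x-leaf with ∈-resp-↭ (map⁺ proj₁ M↭) (∈-resp-↭ A↭ x∈A)
            ... | there x∈N = ∈-resp-↭ (↭-sym B↭) (there x∈N)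
            -- The removed vertex `v` is no leaf: it shares the neighbour `p` with `l`, so it would
            -- equal `l`.
            ... | here refl = ⊥-elim (v∉ (here (leaf-twins x-leaf l-leaf v~p l~p)))
            B-leaf→A : ∀ {x} → x ∈ B → Leaf x → to x ∈ A × Leaf (to x)
            B-leaf→A {x} x∈B x-leaf =
              Equivalence.from (φB≡A (to x)) (x , x∈B , refl) , iso-preserves-leaf φ x-leaf
            -- The iterates start at `suc j`, since `l` itself is known only to lie in `B`.
            orbit : ∀ j → fold l to (suc j) ∈ A × Leaf (fold l to (suc j))
            orbit zero    = B-leaf→A (∈-resp-↭ (↭-sym B↭) (here refl)) l-leaf
            orbit (suc j) with x∈A , x-leaf ← orbit j = B-leaf→A (A-leaf⊆B x∈A x-leaf) x-leaf

        Maximum-covers : ∀ {M} → Maximum M → ∀ x → x ∈ map proj₁ M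
        Maximum-covers {M} maxM x = decidable-stable (x ∈? map proj₁ M) λ x∉ →
          no-endless-walk Missed step (~-sym (proj₂ (noIsolated x))) (M , maxM , x∉)
          where
          -- The maximum matching may change at every step of the walk.
          Missed : V → V → Set
          Missed _ v = ∃[ M ] (Maximum M × v ∉ map proj₁ M)
          step : ∀ {u v} → Missed u v → ∃₂ λ y z → v ~ y × y ~ z × y ≢ u × z ≢ v × Missed y z
          step {u} {v} (M , maxM , v∉) with any? (λ y → adj? v y ×-dec ¬? (y Fin.≟ u))
          -- With no neighbour other than `u`, the missed vertex `v` would be a leaf.
          ... | no ¬other = ⊥-elim (v∉ (Maximum-contains-leaf maxM λ v~w v~w′ →
                  trans (onlyNeighbour v~w) (sym (onlyNeighbour v~w′))))
            where
            onlyNeighbour : ∀ {w} → v ~ w → w ≡ u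
            onlyNeighbour {w} v~w =
              decidable-stable (w Fin.≟ u) λ w≢u → ¬other (w , v~w , w≢u)
          ... | yes (y , v~y , y≢u)
                with z , N , _ , z~y , z∉ , maxN ← exchange maxM v∉ v~y =
                y , z , v~y , ~-sym z~y , y≢u , z∉ ∘ here , (_ , maxN , z∉)

        IsoUnique⇒GrundyTotalNumberIs-order : GrundyTotalNumberIs T n
        IsoUnique⇒GrundyTotalNumberIs-order
          with s , g@((u , _) , _) ← ∃IsGrundyTotalSeq
          with M , refl , maxM ← Grundy⇒Maximum g =
          (s , g , ≤-antisym (Unique⇒length≤ u) (all∈⇒≤length (Maximum-covers maxM))) ,
          λ _ t-on → Unique⇒length≤ (proj₁ t-on)

theorem5p6 : (T : Graph) → Forest T → NoIsolated T → TwinFree T →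
    IsoUniqueGrundyTotal T ⇔ GrundyTotalNumberIs T (order T)
theorem5p6 T forest noIsolated twinFree = mk⇔
  (IsoUnique⇒GrundyTotalNumberIs-order T forest noIsolated twinFree)
  (GrundyTotalNumberIs-order⇒IsoUnique T)
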